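{- Both $\mathrm{spd}(\mathrm{DISJ}_n)$ and $\mathrm{uspd}(\mathrm{DISJ}_n)$ are $2^{\Omega(n)}$.
   Context: $\mathrm{DISJ}_n:\{0,1\}^n\times\{0,1\}^n\to\{0,1\}$ is defined by $\mathrm{DISJ}_n(x,y)=1$ iff $x_i\wedge y_i=0$ for all $i\in[n]$. For $f:\{0,1\}^n\times\{0,1\}^n\to\{0,1\}$, let $G_f=(U,V,E)$ be the bipartite graph with $U=V=\{0,1\}^n$ (as disjoint sides) and $(u,v)\in E$ iff $f(u,v)=1$. The standard projective dimension $\mathrm{spd}(f)$ (over a field $\mathbb{F}$) is the smallest $d$ such that there is a map $\phi$ assigning to each vertex of $U\cup V$ a subspace of $\mathbb{F}^d$ spanned by a subset of the standard basis vectors, such that for all $(u,v)\in U\times V$: $\phi(u)\cap\phi(v)\ne\{0\}$ iff $(u,v)\in E$. $\mathrm{uspd}(f)$ is the smallest $d$ for which such a $\phi$ exists with, in addition, $\dim(\phi(u)\cap\phi(v))\le 1$ for all $(u,v)\in U\times V$. -}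

module Defs where

open import Level using (Level; _⊔_) renaming (suc to lsuc)
open import Algebra.Bundles using (CommutativeRing)
open import Algebra.Definitions using (Invertible)
import Algebra.Properties.Monoid.Sum as MonoidSum
open import Data.Bool using (Bool; true; false; if_then_else_; _∧_)
import Data.Bool.Properties as Bool
open import Data.Fin
  using (Fin; zero; suc; _≟_; combine; remQuot; join; splitAt; finToFun; funToFin)
open import Data.Fin.Properties
  using (all?; 2↔Bool; finToFun-funToFin; splitAt-join; remQuot-combine)
open import Data.Fin.Subset using (Subset; _∈_; _∉_; Nonempty; ⁅_⁆) renaming (_∩_ to _∩ˢ_)
open import Data.Fin.Subset.Properties
  using (nonempty?; _∈?_; anySubset?; x∈p∩q⁺; x∈p∩q⁻; x∈⁅x⁆; x∈⁅y⁆⇒x≡y)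
open import Data.Nat using (ℕ; zero; suc; _+_; _*_; _^_; _≤_; _≥_; z≤n; s≤s)
open import Data.Product using (∃; ∃-syntax; _×_; _,_; proj₁; proj₂)
open import Data.Sum as Sum using (_⊎_; inj₁; inj₂)
open import Data.Vec using (Vec; lookup; tabulate)
open import Data.Vec.Functional using (Vector)
import Data.Vec.Properties as Vec
open import Function using (_∘_; Inverse)
open import Function.Bundles using (_⇔_; mk⇔; Equivalence)
open import Relation.Binary.PropositionalEquality
  using (_≡_; _≢_; _≗_; refl; sym; trans; cong; cong₂; subst; subst₂)
open import Relation.Nullary using (¬_; Dec; yes; no; does; contradiction)
open import Relation.Nullary.Decidable using (map′; _×-dec_; _→-dec_)
open import Relation.Unary using (Pred; _∩_; _≐_)

private
  variable
    c ℓ p : Level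
    n d : ℕ

BoolFun : ℕ → Set
BoolFun n = Vec Bool n × Vec Bool n → Bool

DISJ : ∀ n → BoolFun n
DISJ n (x , y) = does (all? λ (i : Fin n) → (lookup x i ∧ lookup y i) Bool.≟ false)

-- The bipartite graph G_f: the two sides of the disjoint union are U and V.

Vertex : ℕ → Set
Vertex n = Vec Bool n ⊎ Vec Bool n

Edge : BoolFun n → Vec Bool n → Vec Bool n → Set
Edge f u v = f (u , v) ≡ true

-- g(n) = 2^Ω(n) means g(n) ≥ 2^(κ n) for some real κ > 0 and all large n.
-- Shrinking κ, one may take κ = a / b rational; then raise to the power b.

Is2^Ω : (ℕ → ℕ) → Set
Is2^Ω g = ∃[ a ] ∃[ b ] ∃[ N ]
  1 ≤ a × 1 ≤ b × (∀ n → n ≥ N → 2 ^ (a * n) ≤ g n ^ b)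

record Field c ℓ : Set (lsuc (c ⊔ ℓ)) where
  field
    commutativeRing : CommutativeRing c ℓ
  open CommutativeRing commutativeRing public
    using (Carrier; _≈_; 0#; 1#) renaming (_*_ to _·_)
  field
    1≉0        : ¬ 1# ≈ 0#
    invertible : ∀ x → ¬ x ≈ 0# → Invertible _≈_ 1# _·_ x

module LinearAlgebra (F : Field c ℓ) where

  open Field F
  open CommutativeRing commutativeRing using (+-monoid)
  open MonoidSum +-monoid using (sum)

  Vect : ℕ → Set c
  Vect d = Vector Carrier d

  infix 4 _≋_
  _≋_ : Vect d → Vect d → Set ℓ
  v ≋ w = ∀ i → v i ≈ w i

  0ᵛ : Vect d
  0ᵛ _ = 0#

  basisVector : Fin d → Vect d
  basisVector i j = if does (i ≟ j) then 1# else 0#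

  linComb : ∀ {k} → Vector Carrier k → Vector (Vect d) k → Vect d
  linComb a v j = sum (λ i → a i · v i j)

  span : Pred (Vect d) p → Pred (Vect d) (c ⊔ ℓ ⊔ p)
  span {d = d} X w = ∃[ k ] ∃ λ (v : Vector (Vect d) k) → ∃ λ (a : Vector Carrier k) →
    (∀ i → X (v i)) × w ≋ linComb a v

  ⟪_⟫ : Subset d → Pred (Vect d) (c ⊔ ℓ)
  ⟪ S ⟫ = span (λ w → ∃[ i ] i ∈ S × w ≋ basisVector i)

  ｛0｝ : Pred (Vect d) ℓ
  ｛0｝ w = w ≋ 0ᵛ

  record IsBasis (W : Pred (Vect d) p) {k} (b : Vector (Vect d) k) : Set (c ⊔ ℓ ⊔ p) where
    field
      member      : ∀ i → W (b i)
      independent : ∀ a → linComb a b ≋ 0ᵛ → ∀ i → a i ≈ 0#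
      spanning    : ∀ w → W w → ∃[ a ] w ≋ linComb a b

  HasDimension : Pred (Vect d) p → ℕ → Set (c ⊔ ℓ ⊔ p)
  HasDimension {d = d} W k = ∃ λ (b : Vector (Vect d) k) → IsBasis W b

  -- An assignment of coordinate subspaces is given by the sets of standard
  -- basis vectors spanning them: vertex x is assigned ⟪ φ x ⟫ ⊆ F^d.
  Assignment : ℕ → ℕ → Set
  Assignment n d = Vertex n → Subset d

  meet : Assignment n d → Vec Bool n → Vec Bool n → Pred (Vect d) (c ⊔ ℓ)
  meet φ u v = ⟪ φ (inj₁ u) ⟫ ∩ ⟪ φ (inj₂ v) ⟫

  Realizes : BoolFun n → Assignment n d → Set (c ⊔ ℓ)
  Realizes f φ = ∀ u v → (¬ (meet φ u v ≐ ｛0｝)) ⇔ Edge f u v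

  Unambiguous : Assignment n d → Set (c ⊔ ℓ)
  Unambiguous φ = ∀ u v → ∃[ k ] HasDimension (meet φ u v) k × k ≤ 1

  HasSpdMap : BoolFun n → ℕ → Set (c ⊔ ℓ)
  HasSpdMap {n} f d = ∃ λ (φ : Assignment n d) → Realizes f φ

  HasUspdMap : BoolFun n → ℕ → Set (c ⊔ ℓ)
  HasUspdMap {n} f d = ∃ λ (φ : Assignment n d) → Realizes f φ × Unambiguous φ

IsSmallest : Pred ℕ p → ℕ → Set p
IsSmallest P d = P d × (∀ d′ → P d′ → d ≤ d′)

-- Both minima exist: a map exists in dimension 2^n, and whether one exists
-- in a given dimension is decidable.

private

  smallest : {P : Pred ℕ p} → (∀ d → Dec (P d)) → ∀ N → P N → ∃ (IsSmallest P)
  smallest P? zero    pN = 0 , pN , λ _ _ → z≤n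
  smallest P? (suc N) pN with P? 0
  ... | yes p0 = 0 , p0 , λ _ _ → z≤n
  ... | no ¬p0 with smallest (P? ∘ suc) N pN
  ...   | d , pd , min = suc d , pd , λ
    { zero p0 → contradiction p0 ¬p0 ; (suc d′) pd′ → s≤s (min d′ pd′) }

  ⇔-dec : ∀ {a b} {A : Set a} {B : Set b} → Dec A → Dec B → Dec (A ⇔ B)
  ⇔-dec A? B? = map′ (λ (f , g) → mk⇔ f g) (λ e → Equivalence.to e , Equivalence.from e)
    ((A? →-dec B?) ×-dec (B? →-dec A?))

  encode : Vec Bool n → Fin (2 ^ n)
  encode x = funToFin (Inverse.from 2↔Bool ∘ lookup x)

  decode : Fin (2 ^ n) → Vec Bool n
  decode i = tabulate (Inverse.to 2↔Bool ∘ finToFun i)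

  decode-encode : (x : Vec Bool n) → decode (encode x) ≡ x
  decode-encode x = trans
    (Vec.tabulate-cong λ i → trans
      (cong (Inverse.to 2↔Bool) (finToFun-funToFin (Inverse.from 2↔Bool ∘ lookup x) i))
      (Inverse.strictlyInverseˡ 2↔Bool (lookup x i)))
    (Vec.tabulate∘lookup x)

  allVec? : {P : Vec Bool n → Set p} → (∀ x → Dec (P x)) → Dec (∀ x → P x)
  allVec? {P = P} P? = map′ (λ h x → subst P (decode-encode x) (h (encode x)))
    (λ h i → h (decode i)) (all? (P? ∘ decode))

  -- An assignment is encoded, up to pointwise equality, as a single subset of
  -- (vertices of G_f) × (basis vectors), so that anySubset? can search them.

  fromTable : Subset ((2 ^ n + 2 ^ n) * d) → Vertex n → Subset d
  fromTable {n} t (inj₁ u) =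
    tabulate λ j → lookup t (combine (join (2 ^ n) (2 ^ n) (inj₁ (encode u))) j)
  fromTable {n} t (inj₂ v) =
    tabulate λ j → lookup t (combine (join (2 ^ n) (2 ^ n) (inj₂ (encode v))) j)

  toTable : (Vertex n → Subset d) → Subset ((2 ^ n + 2 ^ n) * d)
  toTable {n} {d} φ = tabulate λ i → let (x , j) = remQuot d i in
    lookup (φ (Sum.map decode decode (splitAt (2 ^ n) x))) j

  fromTable-toTable : (φ : Vertex n → Subset d) → fromTable (toTable φ) ≗ φ
  fromTable-toTable {n} {d} φ = λ
    { (inj₁ u) → trans (Vec.tabulate-cong (entry (inj₁ (encode u))))
        (trans (Vec.tabulate∘lookup _) (cong (φ ∘ inj₁) (decode-encode u)))
    ; (inj₂ v) → trans (Vec.tabulate-cong (entry (inj₂ (encode v))))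
        (trans (Vec.tabulate∘lookup _) (cong (φ ∘ inj₂) (decode-encode v))) }
    where
    entry : ∀ x j → lookup (toTable φ) (combine (join (2 ^ n) (2 ^ n) x) j)
                  ≡ lookup (φ (Sum.map decode decode x)) j
    entry x j = trans (Vec.lookup∘tabulate _ (combine (join (2 ^ n) (2 ^ n) x) j))
      (trans (cong (λ (y , k) → lookup (φ (Sum.map decode decode (splitAt (2 ^ n) y))) k)
                   (remQuot-combine (join (2 ^ n) (2 ^ n) x) j))
             (cong (λ y → lookup (φ (Sum.map decode decode y)) j)
                   (splitAt-join (2 ^ n) (2 ^ n) x)))

  anyAssignment? : {R : Subset d → Subset d → Bool → Set p} →
    (∀ S T b → Dec (R S T b)) → (f : BoolFun n) →
    Dec (∃ λ (φ : Vertex n → Subset d) → ∀ u v → R (φ (inj₁ u)) (φ (inj₂ v)) (f (u , v)))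
  anyAssignment? {R = R} R? f = map′
    (λ (t , h) → fromTable t , h)
    (λ (φ , h) → toTable φ , λ u v → subst₂ (λ S T → R S T (f (u , v)))
       (sym (fromTable-toTable φ (inj₁ u))) (sym (fromTable-toTable φ (inj₂ v))) (h u v))
    (anySubset? λ t → allVec? λ u → allVec? λ v →
       R? (fromTable t (inj₁ u)) (fromTable t (inj₂ v)) (f (u , v)))

module _ (F : Field c ℓ) where

  open LinearAlgebra F
  private
    open module 𝔽 = CommutativeRing (Field.commutativeRing F)
      using (Carrier; _≈_; 0#; 1#; +-monoid; setoid)
      renaming (_*_ to _·_; _+_ to _⊕_)
    open MonoidSum +-monoid using (sum; sum-cong-≋; sum-replicate-zero)
    open import Relation.Binary.Reasoning.Setoid setoid

    basis-same : (i : Fin d) → basisVector i i ≈ 1#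
    basis-same i with i ≟ i
    ... | yes _ = 𝔽.refl
    ... | no  n = contradiction refl n

    basis-other : {i j : Fin d} → i ≢ j → basisVector i j ≈ 0#
    basis-other {i = i} {j} i≢j with i ≟ j
    ... | yes e = contradiction e i≢j
    ... | no  _ = 𝔽.refl

    basis≉0 : (i : Fin d) → ¬ basisVector i ≋ 0ᵛ
    basis≉0 i h = Field.1≉0 F (𝔽.trans (𝔽.sym (basis-same i)) (h i))

    basis∈ : {S : Subset d} {i : Fin d} → i ∈ S → ⟪ S ⟫ (basisVector i)
    basis∈ {i = i} i∈S = 1 , (λ _ → basisVector i) , (λ _ → 1#) ,
      (λ _ → i , i∈S , λ _ → 𝔽.refl) ,
      λ _ → 𝔽.sym (𝔽.trans (𝔽.+-identityʳ _) (𝔽.*-identityˡ _))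

    0∈ : (S : Subset d) {w : Vect d} → w ≋ 0ᵛ → ⟪ S ⟫ w
    0∈ S w≋0 = 0 , (λ ()) , (λ ()) , (λ ()) , w≋0

    off-support : {S : Subset d} {w : Vect d} → ⟪ S ⟫ w → ∀ {j} → j ∉ S → w j ≈ 0#
    off-support {S = S} {w} (k , v , a , v∈ , w≋) {j} j∉S = begin
      w j                      ≈⟨ w≋ j ⟩
      sum (λ i → a i · v i j)  ≈⟨ sum-cong-≋ term ⟩
      sum {k} (λ _ → 0#)       ≈⟨ sum-replicate-zero k ⟩
      0#                       ∎
      where
      term : ∀ i → a i · v i j ≈ 0#
      term i with v∈ i
      ... | s , s∈S , vi≋ = 𝔽.trans
        (𝔽.*-congˡ (𝔽.trans (vi≋ j) (basis-other {i = s} {j} λ { refl → j∉S s∈S }))) (𝔽.zeroʳ _)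

    meet-support : {S T : Subset d} {w : Vect d} → (⟪ S ⟫ ∩ ⟪ T ⟫) w →
      ∀ {j} → j ∉ (S ∩ˢ T) → w j ≈ 0#
    meet-support {S = S} {T} (wS , wT) {j} j∉ with j ∈? S | j ∈? T
    ... | no j∉S  | _       = off-support wS j∉S
    ... | yes _   | no j∉T  = off-support wT j∉T
    ... | yes j∈S | yes j∈T = contradiction (x∈p∩q⁺ (j∈S , j∈T)) j∉

    basis∈meet : {S T : Subset d} {i : Fin d} → i ∈ (S ∩ˢ T) → (⟪ S ⟫ ∩ ⟪ T ⟫) (basisVector i)
    basis∈meet {S = S} {T} i∈ with x∈p∩q⁻ S T i∈
    ... | i∈S , i∈T = basis∈ i∈S , basis∈ i∈T

    Subsingleton : Subset d → Set
    Subsingleton S = ∀ i → i ∈ S → ∀ j → j ∈ S → i ≡ j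

    subsingleton? : (S : Subset d) → Dec (Subsingleton S)
    subsingleton? S = all? λ i → (i ∈? S) →-dec (all? λ j → (j ∈? S) →-dec (i ≟ j))

    nonempty⇒nonzero : {S T : Subset d} → Nonempty (S ∩ˢ T) → ¬ ((⟪ S ⟫ ∩ ⟪ T ⟫) ≐ ｛0｝)
    nonempty⇒nonzero (i , i∈) (⊆0 , _) = basis≉0 i (⊆0 (basis∈meet i∈))

    nonzero⇒nonempty : {S T : Subset d} → ¬ ((⟪ S ⟫ ∩ ⟪ T ⟫) ≐ ｛0｝) → Nonempty (S ∩ˢ T)
    nonzero⇒nonempty {S = S} {T} nz with nonempty? (S ∩ˢ T)
    ... | yes ne = ne
    ... | no  em = contradiction zero-meet nz
      where
      zero-meet : (⟪ S ⟫ ∩ ⟪ T ⟫) ≐ ｛0｝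
      zero-meet = (λ {_} w∈ j → meet-support w∈ λ j∈ → em (j , j∈))
                , (λ {_} w≋0 → 0∈ S w≋0 , 0∈ T w≋0)

    Dim≤1 : Subset d → Subset d → Set _
    Dim≤1 S T = ∃[ k ] HasDimension (⟪ S ⟫ ∩ ⟪ T ⟫) k × k ≤ 1

    dim≤1⇒subsingleton : {S T : Subset d} → Dim≤1 S T → Subsingleton (S ∩ˢ T)
    dim≤1⇒subsingleton {S = S} {T} (k , (b , isB) , k≤1) i i∈ j j∈ with i ≟ j
    ... | yes e = e
    dim≤1⇒subsingleton (zero , (b , isB) , k≤1) i i∈ j j∈ | no i≢j =
      contradiction (proj₂ (IsBasis.spanning isB _ (basis∈meet i∈))) (basis≉0 i)
    dim≤1⇒subsingleton (suc zero , (b , isB) , k≤1) i i∈ j j∈ | no i≢j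
      with IsBasis.spanning isB _ (basis∈meet i∈) | IsBasis.spanning isB _ (basis∈meet j∈)
    ... | x , ei≋ | y , ej≋ = contradiction 1≈0 (Field.1≉0 F)
      where
      x₀ = x zero
      y₀ = y zero
      β = b zero
      xβi≈1 : x₀ · β i ≈ 1#
      xβi≈1 = 𝔽.trans (𝔽.sym (𝔽.trans (ei≋ i) (𝔽.+-identityʳ _))) (basis-same i)
      xβj≈0 : x₀ · β j ≈ 0#
      xβj≈0 = 𝔽.trans (𝔽.sym (𝔽.trans (ei≋ j) (𝔽.+-identityʳ _))) (basis-other {i = i} {j} i≢j)
      yβj≈1 : y₀ · β j ≈ 1#
      yβj≈1 = 𝔽.trans (𝔽.sym (𝔽.trans (ej≋ j) (𝔽.+-identityʳ _))) (basis-same j)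
      1≈0 : 1# ≈ 0#
      1≈0 = begin
        1#                          ≈⟨ yβj≈1 ⟨
        y₀ · β j                    ≈⟨ 𝔽.*-congˡ (𝔽.*-identityˡ _) ⟨
        y₀ · (1# · β j)             ≈⟨ 𝔽.*-congˡ (𝔽.*-congʳ xβi≈1) ⟨
        y₀ · ((x₀ · β i) · β j)     ≈⟨ 𝔽.*-congˡ (𝔽.*-congʳ (𝔽.*-comm _ _)) ⟩
        y₀ · ((β i · x₀) · β j)     ≈⟨ 𝔽.*-congˡ (𝔽.*-assoc _ _ _) ⟩
        y₀ · (β i · (x₀ · β j))     ≈⟨ 𝔽.*-congˡ (𝔽.*-congˡ xβj≈0) ⟩
        y₀ · (β i · 0#)             ≈⟨ 𝔽.*-congˡ (𝔽.zeroʳ _) ⟩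
        y₀ · 0#                     ≈⟨ 𝔽.zeroʳ _ ⟩
        0#                          ∎
    dim≤1⇒subsingleton (suc (suc _) , _ , s≤s ()) i i∈ j j∈ | no _

    subsingleton⇒dim≤1 : {S T : Subset d} → Subsingleton (S ∩ˢ T) → Dim≤1 S T
    subsingleton⇒dim≤1 {S = S} {T} sub with nonempty? (S ∩ˢ T)
    ... | no em = 0 , ((λ ()) , record
      { member      = λ ()
      ; independent = λ _ _ ()
      ; spanning    = λ w w∈ → (λ ()) , λ j → meet-support w∈ (λ j∈ → em (j , j∈))
      }) , z≤n
    ... | yes (i , i∈) = 1 , ((λ _ → basisVector i) , record
      { member      = λ _ → basis∈meet i∈
      ; independent = λ { a h zero → 𝔽.trans (𝔽.sym (single (a zero))) (h i) }
      ; spanning    = λ w w∈ → (λ _ → w i) , expand w w∈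
      }) , s≤s z≤n
      where
      single : ∀ x → x · basisVector i i ⊕ 0# ≈ x
      single x = 𝔽.trans (𝔽.+-identityʳ _)
        (𝔽.trans (𝔽.*-congˡ (basis-same i)) (𝔽.*-identityʳ _))
      expand : ∀ w → (⟪ S ⟫ ∩ ⟪ T ⟫) w → ∀ j → w j ≈ w i · basisVector i j ⊕ 0#
      expand w w∈ j with i ≟ j
      ... | yes refl = 𝔽.sym (𝔽.trans (𝔽.+-identityʳ _) (𝔽.*-identityʳ _))
      ... | no  i≢j  = 𝔽.trans (meet-support w∈ (λ j∈ → i≢j (sub i i∈ j j∈)))
        (𝔽.sym (𝔽.trans (𝔽.+-identityʳ _) (𝔽.zeroʳ _)))

    edge? : (S T : Subset d) (b : Bool) → Dec ((¬ ((⟪ S ⟫ ∩ ⟪ T ⟫) ≐ ｛0｝)) ⇔ b ≡ true)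
    edge? S T b =
      ⇔-dec (map′ nonempty⇒nonzero nonzero⇒nonempty (nonempty? (S ∩ˢ T))) (b Bool.≟ true)

    hasSpdMap? : (f : BoolFun n) → ∀ d → Dec (HasSpdMap f d)
    hasSpdMap? f d = anyAssignment? edge? f

    hasUspdMap? : (f : BoolFun n) → ∀ d → Dec (HasUspdMap f d)
    hasUspdMap? f d = map′
      (λ (φ , h) → φ , (λ u v → proj₁ (h u v)) , (λ u v → proj₂ (h u v)))
      (λ (φ , r , s) → φ , λ u v → r u v , s u v)
      (anyAssignment? (λ S T b → edge? S T b ×-dec
        map′ subsingleton⇒dim≤1 dim≤1⇒subsingleton (subsingleton? (S ∩ˢ T))) f)

    trivialMap : (f : BoolFun n) → HasUspdMap f (2 ^ n)
    trivialMap {n} f = φ , realizes , λ u v → subsingleton⇒dim≤1 λ i i∈ j j∈ →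
        trans (is-u u v i∈) (sym (is-u u v j∈))
      where
      row : Vec Bool n → Subset (2 ^ n)
      row v = tabulate (λ i → f (decode i , v))
      φ : Assignment n (2 ^ n)
      φ (inj₁ u) = ⁅ encode u ⁆
      φ (inj₂ v) = row v
      is-u : ∀ u v {i} → i ∈ (φ (inj₁ u) ∩ˢ φ (inj₂ v)) → i ≡ encode u
      is-u u v i∈ = x∈⁅y⁆⇒x≡y _ (proj₁ (x∈p∩q⁻ (φ (inj₁ u)) (φ (inj₂ v)) i∈))
      lookup-row : ∀ u v → lookup (row v) (encode u) ≡ f (u , v)
      lookup-row u v = trans (Vec.lookup∘tabulate _ (encode u))
        (cong (λ x → f (x , v)) (decode-encode u))
      realizes : Realizes f φ
      realizes u v = mk⇔
        (λ nz → let (i , i∈) = nonzero⇒nonempty nz in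
          trans (sym (lookup-row u v)) (Vec.[]=⇒lookup
            (subst (_∈ row v) (is-u u v i∈) (proj₂ (x∈p∩q⁻ ⁅ encode u ⁆ (row v) i∈)))))
        (λ e → nonempty⇒nonzero (encode u , x∈p∩q⁺
          (x∈⁅x⁆ _ , Vec.lookup⇒[]= (encode u) (row v) (trans (lookup-row u v) e))))

  abstract

    spd-exists : (f : BoolFun n) → ∃ (IsSmallest (HasSpdMap f))
    spd-exists {n} f = smallest (hasSpdMap? f) (2 ^ n)
      (let (φ , r , _) = trivialMap f in φ , r)

    uspd-exists : (f : BoolFun n) → ∃ (IsSmallest (HasUspdMap f))
    uspd-exists {n} f = smallest (hasUspdMap? f) (2 ^ n) (trivialMap f)

  spd : BoolFun n → ℕ
  spd f = proj₁ (spd-exists f)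

  uspd : BoolFun n → ℕ
  uspd f = proj₁ (uspd-exists f)

{-# OPTIONS --safe #-}
-- A coordinate assignment realizing f is a cover of the edges of G_f by d
-- bicliques, the i-th consisting of the u and v whose sets contain i.  The
-- 2^n edges (u , ū) of DISJ, with ū the complement of u, form a fooling set:
-- if one biclique contains (u , ū) and (v , v̄), then (u , v̄) and (v , ū) are
-- edges too, so u ⊆ v ⊆ u.  Hence d ≥ 2^n.
module Submission where

open import Defs
open import Algebra.Bundles using (CommutativeRing)
import Algebra.Properties.Monoid.Sum as MonoidSum
open import Data.Bool using (Bool; true; false; not; _∧_)
import Data.Bool.Properties as Bool
open import Data.Empty using (⊥-elim)
open import Data.Fin using (Fin; zero; suc; _≟_; combine; finToFun; funToFin)
open import Data.Fin.Properties using (all?; 2↔Bool; funToFin-finToFin; injective⇒≤)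
open import Data.Fin.Subset using (Subset; _∈_; _∉_; Nonempty) renaming (_∩_ to _∩ˢ_)
open import Data.Fin.Subset.Properties using (nonempty?; _∈?_; x∈p∩q⁺; x∈p∩q⁻)
open import Data.Nat using (zero; suc; _^_; _≤_; z≤n; s≤s)
open import Data.Nat.Properties using (*-identityˡ; *-identityʳ)
open import Data.Product using (∃-syntax; _×_; _,_; proj₁; proj₂)
open import Data.Sum using (inj₁; inj₂)
open import Data.Vec using (Vec; lookup; map; tabulate)
open import Data.Vec.Properties using (lookup-map; lookup∘tabulate)
open import Data.Vec.Relation.Binary.Pointwise.Extensional using (ext; Pointwise-≡⇒≡)
open import Function using (_∘_)
open import Function.Properties.Inverse using (↔⇒↣)
open import Function.Bundles using (Equivalence; Injection; Inverse)
open import Function.Definitions using (Injective)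
open import Relation.Binary.PropositionalEquality
  using (_≡_; _≗_; refl; sym; trans; cong; cong₂; subst; subst₂)
open import Relation.Nullary using (¬_; yes; no; invert; proof; contradiction; Reflects)
open import Relation.Nullary.Decidable using (dec-true)
open import Relation.Unary using (Pred; _∩_; _≐_)

-- Replaces function extensionality: below, `finToFun x` and `finToFun y` are known to agree only
-- pointwise.
funToFin-cong : ∀ {m n} {f g : Fin m → Fin n} → f ≗ g → funToFin f ≡ funToFin g
funToFin-cong {zero}  f≗g = refl
funToFin-cong {suc m} f≗g = cong₂ combine (f≗g zero) (funToFin-cong (f≗g ∘ suc))

finToFun-injective : ∀ {m n} {x y : Fin (m ^ n)} → finToFun {m} {n} x ≗ finToFun y → x ≡ y
finToFun-injective {m} {n} {x} {y} eq =
  trans (sym (funToFin-finToFin {n} {m} x))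
    (trans (funToFin-cong eq) (funToFin-finToFin {n} {m} y))

bits : ∀ {n} → Fin (2 ^ n) → Vec Bool n
bits x = tabulate (Inverse.to 2↔Bool ∘ finToFun x)

bits-injective : ∀ {n} → Injective _≡_ _≡_ (bits {n})
bits-injective {n} {x} {y} eq = finToFun-injective λ i →
  Injection.injective (↔⇒↣ 2↔Bool)
    (trans (sym (lookup∘tabulate _ i)) (trans (cong (λ v → lookup v i) eq) (lookup∘tabulate _ i)))

-- Precomposing with `bits` gives an injection from `Fin (2 ^ n)` into `Fin d`, so the pigeonhole
-- principle applies.
injection⇒2^n≤d : ∀ {n d} {f : Vec Bool n → Fin d} → Injective _≡_ _≡_ f → 2 ^ n ≤ d
injection⇒2^n≤d inj = injective⇒≤ (bits-injective ∘ inj)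

edge⇒disjoint : ∀ {n} (u v : Vec Bool n) → Edge (DISJ n) u v →
  ∀ i → lookup u i ∧ lookup v i ≡ false
edge⇒disjoint {n} u v e =
  -- `DISJ` is the Boolean part of a decision; transporting its `Reflects` proof along `e` recovers
  -- the decided statement.
  invert (subst (Reflects _) e (proof (all? λ i → (lookup u i ∧ lookup v i) Bool.≟ false)))

edge-complement : ∀ {n} (u : Vec Bool n) → Edge (DISJ n) u (map not u)
edge-complement u = dec-true (all? _) λ i →
  trans (cong (lookup u i ∧_) (lookup-map i not u)) (Bool.∧-inverseʳ (lookup u i))

-- With `false` below `true`, the hypotheses say that `a` is below `b` and `b` below `a`. Each mixed
-- case refutes one of them.
∧-not-antisym : ∀ {a b} → a ∧ not b ≡ false → b ∧ not a ≡ false → a ≡ b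
∧-not-antisym {true}  {true}  _ _ = refl
∧-not-antisym {false} {false} _ _ = refl

fooling : ∀ {n} {u v : Vec Bool n} →
  Edge (DISJ n) u (map not v) → Edge (DISJ n) v (map not u) → u ≡ v
fooling {u = u} {v} uv̄ vū = Pointwise-≡⇒≡ (ext λ i → ∧-not-antisym
  (subst (λ b → lookup u i ∧ b ≡ false) (lookup-map i not v) (edge⇒disjoint u (map not v) uv̄ i))
  (subst (λ b → lookup v i ∧ b ≡ false) (lookup-map i not u) (edge⇒disjoint v (map not u) vū i)))

module _ {c ℓ} (F : Field c ℓ) where

  open LinearAlgebra F
  private
    open module 𝔽 = CommutativeRing (Field.commutativeRing F)
      using (_≈_; 0#; +-monoid) renaming (_*_ to _·_)
    open MonoidSum +-monoid using (sum-cong-≋; sum-replicate-zero)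

  -- The vectors whose coordinate `j` is zero form a subspace, so they contain the span of any of
  -- their subsets.
  span-vanishes : ∀ {d p} (X : Pred (Vect d) p) {j} →
    (∀ {v} → X v → v j ≈ 0#) → ∀ {w} → span X w → w j ≈ 0#
  span-vanishes X {j} X-vanishes (k , v , a , v∈X , w≋) =
    𝔽.trans (w≋ j)
      (𝔽.trans (sum-cong-≋ λ i → 𝔽.trans (𝔽.*-congˡ (X-vanishes (v∈X i))) (𝔽.zeroʳ (a i)))
        (sum-replicate-zero k))

  X⊆spanX : ∀ {d p} (X : Pred (Vect d) p) {w} → X w → span X w
  X⊆spanX X {w} w∈X = 1 , (λ _ → w) , (λ _ → Field.1# F) , (λ _ → w∈X) ,
    λ _ → 𝔽.sym (𝔽.trans (𝔽.+-identityʳ _) (𝔽.*-identityˡ _))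

  0∈span : ∀ {d p} (X : Pred (Vect d) p) {w} → w ≋ 0ᵛ → span X w
  0∈span X w≋0 = 0 , (λ ()) , (λ ()) , (λ ()) , w≋0

  Basis : ∀ {d} → Subset d → Pred (Vect d) ℓ
  Basis S w = ∃[ i ] i ∈ S × w ≋ basisVector i

  basisVector≉0 : ∀ {d} (i : Fin d) → ¬ basisVector i ≋ 0ᵛ
  basisVector≉0 i eᵢ≋0 with i ≟ i | eᵢ≋0 i
  ... | yes _  | 1≈0 = Field.1≉0 F 1≈0
  ... | no i≢i | _   = i≢i refl

  ⟪⟫-support : ∀ {d} {S : Subset d} {j w} → j ∉ S → ⟪ S ⟫ w → w j ≈ 0#
  ⟪⟫-support {S = S} {j} j∉S = span-vanishes (Basis S) λ { (i , i∈S , v≋eᵢ) → 𝔽.trans (v≋eᵢ j) (off i i∈S) }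
    where
    off : ∀ i → i ∈ S → basisVector i j ≈ 0#
    off i i∈S with i ≟ j
    ... | yes refl = contradiction i∈S j∉S
    ... | no _     = 𝔽.refl

  common⇒nonzero : ∀ {d} {S T : Subset d} {i} → i ∈ S → i ∈ T →
    ¬ ((⟪ S ⟫ ∩ ⟪ T ⟫) ≐ ｛0｝)
  common⇒nonzero {S = S} {T} {i} i∈S i∈T (⊆0 , _) = basisVector≉0 i
    (⊆0 (X⊆spanX (Basis S) (i , i∈S , λ _ → 𝔽.refl) , X⊆spanX (Basis T) (i , i∈T , λ _ → 𝔽.refl)))

  -- The hypothesis is a mere negation, but nonemptiness of a finite subset is decidable, so an
  -- actual index can be extracted. If the sets are disjoint, every coordinate `j` lies outside one
  -- of them and vanishes on the meet.
  nonzero⇒common : ∀ {d} {S T : Subset d} → ¬ ((⟪ S ⟫ ∩ ⟪ T ⟫) ≐ ｛0｝) → Nonempty (S ∩ˢ T)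
  nonzero⇒common {S = S} {T} nonzero with nonempty? (S ∩ˢ T)
  ... | yes S∩T≢∅ = S∩T≢∅
  ... | no  S∩T≡∅ = ⊥-elim (nonzero
    ((λ (w∈S , w∈T) → vanishes w∈S w∈T) , λ w≋0 → 0∈span (Basis S) w≋0 , 0∈span (Basis T) w≋0))
    where
    vanishes : ∀ {w} → ⟪ S ⟫ w → ⟪ T ⟫ w → w ≋ 0ᵛ
    vanishes w∈S w∈T j with j ∈? S
    ... | no  j∉S = ⟪⟫-support j∉S w∈S
    ... | yes j∈S = ⟪⟫-support (λ j∈T → S∩T≡∅ (j , x∈p∩q⁺ (j∈S , j∈T))) w∈T

  spdMap-DISJ⇒2^n≤d : ∀ {n d} → HasSpdMap (DISJ n) d → 2 ^ n ≤ d
  spdMap-DISJ⇒2^n≤d {n} {d} (φ , realizes) = injection⇒2^n≤d witness-injective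
    where
    common : (u : Vec Bool n) → Nonempty (φ (inj₁ u) ∩ˢ φ (inj₂ (map not u)))
    common u = nonzero⇒common (Equivalence.from (realizes u (map not u)) (edge-complement u))

    -- A biclique covering the edge between `u` and its complement.
    witness : Vec Bool n → Fin d
    witness u = proj₁ (common u)

    witness∈ : ∀ u → witness u ∈ φ (inj₁ u) × witness u ∈ φ (inj₂ (map not u))
    witness∈ u = x∈p∩q⁻ (φ (inj₁ u)) _ (proj₂ (common u))

    -- A shared index puts one basis vector in the subspaces of both `u` and `map not v`, which
    -- forces an edge.
    cross : ∀ u v → witness u ≡ witness v → Edge (DISJ n) u (map not v)
    cross u v eq = Equivalence.to (realizes u (map not v))
      (common⇒nonzero (proj₁ (witness∈ u))
        (subst (_∈ φ (inj₂ (map not v))) (sym eq) (proj₂ (witness∈ v))))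

    witness-injective : Injective _≡_ _≡_ witness
    witness-injective {u} {v} eq = fooling (cross u v eq) (cross v u (sym eq))

2^n≤g⇒Is2^Ω : ∀ {g} → (∀ n → 2 ^ n ≤ g n) → Is2^Ω g
-- The rate is 1 / 1, valid from `n` = 0 on.
2^n≤g⇒Is2^Ω {g} 2^n≤g = 1 , 1 , 0 , s≤s z≤n , s≤s z≤n , λ n _ →
  subst₂ _≤_ (cong (2 ^_) (sym (*-identityˡ n))) (sym (*-identityʳ (g n))) (2^n≤g n)

mainTheorem8 : ∀ {c ℓ} (F : Field c ℓ) →
    Is2^Ω (λ n → spd F (DISJ n)) × Is2^Ω (λ n → uspd F (DISJ n))
mainTheorem8 F =
    2^n≤g⇒Is2^Ω (λ n → spdMap-DISJ⇒2^n≤d F (proj₁ (proj₂ (spd-exists F (DISJ n)))))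
  -- Forgetting unambiguity leaves a map of the first kind in the same dimension, so the same bound
  -- holds.
  , 2^n≤g⇒Is2^Ω (λ n →
      let (φ , realizes , _) = proj₁ (proj₂ (uspd-exists F (DISJ n)))
      in spdMap-DISJ⇒2^n≤d F (φ , realizes))
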